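{- Let $\varphi_6:\mathbb{N}\to\mathbb{N}$ be the function defined as follows. The values $\varphi_6(0),\varphi_6(1),\dots,\varphi_6(29)$ are, in order, $$8,9,5,6,7,2,3,4,0,1,\ 16,17,18,19,20,21,10,11,12,13,\ 14,15,24,25,22,23,28,29,26,27,$$ and for $x\ge 30$, $\varphi_6(x)=x\oplus_2 4$. Then, for all nonnegative integers $a,b$, the Halve Nim position $a^1b^16^1$ is a $\mathcal{P}$-position if and only if $b=\varphi_6(a)$. Furthermore, for $a,b\ge 30$, $a^1b^16^1$ is a $\mathcal{P}$-position if and only if $(a+2)\oplus(b+2)=4$.
   Context: $\mathbb{N}$ is the set of nonnegative integers and $\oplus$ denotes bitwise XOR. The $n$-shifted bitwise sum is $x\oplus_n y=\bigl((x+n)\oplus y\bigr)-n$. Halve Nim is a two-player game played on finitely many piles of coins; players alternate moves and a player who cannot move loses. A move is one of: (i) choose one pile and remove at least one coin from it; (ii) halve the game: simultaneously replace every pile of $m$ coins by a pile of $\lfloor m/2\rfloor$ coins. When there are no coins left, no move is available (halving requires at least one coin to be present). A position is a $\mathcal{P}$-position if the player who is not about to move has a winning strategy (equivalently, every move from it leads to an $\mathcal{N}$-position), and an $\mathcal{N}$-position if the player about to move has a winning strategy. $a^1b^1c^1$ denotes the position with three piles of sizes $a$, $b$, $c$ (a pile of size $0$ is an empty pile); in particular $a^1b^16^1$ has piles of sizes $a$, $b$, $6$. -}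

module Defs where

open import Data.Fin using (fromℕ<)
open import Data.List using (List; _∷_; map)
open import Data.List.Relation.Unary.Any using (Any)
open import Data.Nat using (ℕ; zero; suc; _+_; _*_; _∸_; _<_; _<?_; _/_; _%_)
open import Data.Vec using (Vec; []; _∷_; lookup)
open import Relation.Nullary using (yes; no)

infixl 6 _⊕_ _⊕[_]_
infix 4 _⟶_

-- The bitwise XOR of the k least significant binary digits.
xorDigits : ℕ → ℕ → ℕ → ℕ
xorDigits zero    m n = 0
xorDigits (suc k) m n =
  (m % 2 + n % 2) % 2 + 2 * xorDigits k (m / 2) (n / 2)

-- Both arguments are below 2 ^ (m + n), so m + n digits are enough.
_⊕_ : ℕ → ℕ → ℕ
m ⊕ n = xorDigits (m + n) m n

-- Truncated subtraction is harmless in φ₆: for x ≥ 30 the minuend is at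
-- least 32.
_⊕[_]_ : ℕ → ℕ → ℕ → ℕ
x ⊕[ n ] y = ((x + n) ⊕ y) ∸ n

Position : Set
Position = List ℕ

data Removal : Position → Position → Set where
  here  : ∀ {m n ps} → n < m → Removal (m ∷ ps) (n ∷ ps)
  there : ∀ {m ps qs} → Removal ps qs → Removal (m ∷ ps) (m ∷ qs)

data _⟶_ : Position → Position → Set where
  remove : ∀ {ps qs} → Removal ps qs → ps ⟶ qs
  halve  : ∀ {ps} → Any (0 <_) ps → ps ⟶ map (_/ 2) ps

-- An element of IsN is a winning strategy for the player about to move; an
-- element of IsP is one for the other player. Being inductive, both types
-- consist of strategies that win after finitely many moves.
mutual
  data IsP (p : Position) : Set where
    isP : (∀ {q} → p ⟶ q → IsN q) → IsP p

  data IsN (p : Position) : Set where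
    isN : ∀ {q} → p ⟶ q → IsP q → IsN p

φ₆-table : Vec ℕ 30
φ₆-table =
   8 ∷  9 ∷  5 ∷  6 ∷  7 ∷  2 ∷  3 ∷  4 ∷  0 ∷  1 ∷
  16 ∷ 17 ∷ 18 ∷ 19 ∷ 20 ∷ 21 ∷ 10 ∷ 11 ∷ 12 ∷ 13 ∷
  14 ∷ 15 ∷ 24 ∷ 25 ∷ 22 ∷ 23 ∷ 28 ∷ 29 ∷ 26 ∷ 27 ∷ []

φ₆ : ℕ → ℕ
φ₆ x with x <? 30
... | yes x<30 = lookup φ₆-table (fromℕ< x<30)
... | no  _    = x ⊕[ 2 ] 4

{-# OPTIONS --safe #-}
module Submission where

-- For each c < 7 the 𝒫-positions with third pile c are the graph of an
-- involution φ c, and these seven involutions are verified simultaneously to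
-- form the kernel of the game. For a ≥ 30, φ c is XOR with a constant, after a
-- shift by 2 when c ≥ 4. For c < 4 the constant alternates between c ⊕ 2 and c
-- at a = 56 · 2 ^ k, because halving a position passes to the opposite regime.
-- Consequently, for large a, φ c preserves the blocks [8 q + o , 8 q + o + 8)
-- with a suitable o, and within a regime it commutes with translations by
-- multiples of 8; so the kernel conditions for large a reduce to finitely many.

open import Defs
open import Data.Bool using (if_then_else_)
open import Data.Empty using (⊥)
open import Data.Fin using (fromℕ<)
open import Data.List using ([]; _∷_; map)
open import Data.List.Relation.Unary.Any using (Any; here; there)
open import Data.Nat
open import Data.Nat.DivMod
open import Data.Nat.Divisibility using (m∣m*n)
open import Data.Nat.Induction using (<-wellFounded)
open import Data.Nat.ListAction using (sum)
open import Data.Nat.Logarithm using (⌈log₂_⌉; ⌈log₂⌉-mono-≤; ⌈log₂⌈n/2⌉⌉≡⌈log₂n⌉∸1)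
open import Data.Nat.Properties
open import Data.Nat.Solver using (module +-*-Solver)
open import Data.Parity.Base using (Parity; 0ℙ; 1ℙ) renaming (_⁻¹ to opposite)
open import Data.Parity.Properties using (suc-homo-⁻¹)
open import Data.Product using (_×_; _,_; proj₁; proj₂; ∃)
open import Data.Sum using (_⊎_; inj₁; inj₂)
open import Data.Vec using (Vec; []; _∷_; lookup)
open import Function.Base using (_∘_; case_of_)
open import Function.Bundles using (_⇔_; mk⇔)
open import Function.Construct.Composition using (_⇔-∘_)
open import Induction.WellFounded using (Acc; acc)
open import Relation.Binary.Definitions using (tri<; tri≈; tri>)
open import Relation.Binary.PropositionalEquality
open import Relation.Nullary
open import Relation.Nullary.Decidable using (from-yes; decidable-stable)

-- Arithmetic of bitwise XOR

bit : ℕ → ℕ → ℕ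
bit m n = (m % 2 + n % 2) % 2

xorDigits-00 : ∀ f → xorDigits f 0 0 ≡ 0
xorDigits-00 zero    = refl
xorDigits-00 (suc f) = cong (2 *_) (xorDigits-00 f)

≤1+⇒/2≤ : ∀ {m f} → m ≤ suc f → m / 2 ≤ f
≤1+⇒/2≤ {zero}  _   = z≤n
≤1+⇒/2≤ {suc m} m≤f = ≤-pred (≤-trans (m/n<m (suc m) 2 (s≤s (s≤s z≤n))) m≤f)

-- Digits beyond the length of both numbers are zero. The bound `m ≤ f` on the length is generous,
-- but halving carries it from `suc f` to `f`.
xorDigits-fuel : ∀ f g {m n} → m ≤ f → n ≤ f → m ≤ g → n ≤ g →
                 xorDigits f m n ≡ xorDigits g m n
xorDigits-fuel zero    g       z≤n z≤n _   _   = sym (xorDigits-00 g)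
xorDigits-fuel (suc f) zero    _   _   z≤n z≤n = xorDigits-00 (suc f)
xorDigits-fuel (suc f) (suc g) {m} {n} m≤f n≤f m≤g n≤g =
  cong (λ w → bit m n + 2 * w)
    (xorDigits-fuel f g (≤1+⇒/2≤ m≤f) (≤1+⇒/2≤ n≤f) (≤1+⇒/2≤ m≤g) (≤1+⇒/2≤ n≤g))

⊕≡xorDigits : ∀ f {m n} → m ≤ f → n ≤ f → m ⊕ n ≡ xorDigits f m n
⊕≡xorDigits f {m} {n} = xorDigits-fuel (m + n) f (m≤m+n m n) (m≤n+m n m)

⊕-step : ∀ m n → m ⊕ n ≡ bit m n + 2 * (m / 2 ⊕ n / 2)
⊕-step m n = begin
  -- A surplus digit makes the digit count a successor, so that `xorDigits` unfolds.
  m ⊕ n                                          ≡⟨ ⊕≡xorDigits (suc (m + n)) (m≤n⇒m≤1+n m≤) (m≤n⇒m≤1+n n≤) ⟩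
  bit m n + 2 * xorDigits (m + n) (m / 2) (n / 2) ≡⟨ cong (λ w → bit m n + 2 * w)
                                                      (⊕≡xorDigits (m + n) (≤-trans (m/n≤m m 2) m≤) (≤-trans (m/n≤m n 2) n≤)) ⟨
  bit m n + 2 * (m / 2 ⊕ n / 2)                   ∎
  where
  open ≡-Reasoning
  m≤ = m≤m+n m n
  n≤ = m≤n+m n m

m≡m%2+2*[m/2] : ∀ m → m ≡ m % 2 + 2 * (m / 2)
m≡m%2+2*[m/2] m = trans (m≡m%n+[m/n]*n m 2) (cong (m % 2 +_) (*-comm (m / 2) 2))

[2*m+n]%2≡n%2 : ∀ m n → (2 * m + n) % 2 ≡ n % 2
[2*m+n]%2≡n%2 m n = %-remove-+ˡ n (m∣m*n m)

[2*m+n]/2≡m+n/2 : ∀ m n → (2 * m + n) / 2 ≡ m + n / 2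
[2*m+n]/2≡m+n/2 m n = trans (+-distrib-/-∣ˡ n (m∣m*n m))
  (cong (_+ n / 2) (trans (cong (_/ 2) (*-comm 2 m)) (m*n/n≡m m 2)))

⊕-identityʳ : ∀ m → m ⊕ 0 ≡ m
⊕-identityʳ m = trans (⊕≡xorDigits m ≤-refl z≤n) (go m ≤-refl)
  where
  go : ∀ f {m} → m ≤ f → xorDigits f m 0 ≡ m
  go zero    z≤n = refl
  go (suc f) {m} m≤f = begin
    (m % 2 + 0) % 2 + 2 * xorDigits f (m / 2) 0 ≡⟨ cong₂ (λ x y → x % 2 + 2 * y) (+-identityʳ (m % 2)) (go f (≤1+⇒/2≤ m≤f)) ⟩
    m % 2 % 2 + 2 * (m / 2)                     ≡⟨ cong (_+ 2 * (m / 2)) (m%n%n≡m%n m 2) ⟩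
    m % 2 + 2 * (m / 2)                         ≡⟨ m≡m%2+2*[m/2] m ⟨
    m                                           ∎
    where open ≡-Reasoning

-- XOR with `k` touches only the `j` lowest digits, to which a multiple of `2 ^ j` contributes
-- nothing.
⊕-+ : ∀ j q r {k} → k < 2 ^ j → (2 ^ j * q + r) ⊕ k ≡ 2 ^ j * q + (r ⊕ k)
⊕-+ zero q r {zero} _ = trans (⊕-identityʳ (1 * q + r)) (cong (1 * q +_) (sym (⊕-identityʳ r)))
⊕-+ zero q r {suc _} (s≤s ())
⊕-+ (suc j) q r {k} k< = begin
  (2 * 2 ^ j * q + r) ⊕ k                    ≡⟨ cong (λ x → (x + r) ⊕ k) (*-assoc 2 (2 ^ j) q) ⟩
  (2 * p + r) ⊕ k                            ≡⟨ ⊕-step (2 * p + r) k ⟩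
  bit (2 * p + r) k + 2 * ((2 * p + r) / 2 ⊕ k / 2)
    ≡⟨ cong₂ (λ x y → (x + k % 2) % 2 + 2 * (y ⊕ k / 2)) ([2*m+n]%2≡n%2 p r) ([2*m+n]/2≡m+n/2 p r) ⟩
  bit r k + 2 * ((p + r / 2) ⊕ k / 2)        ≡⟨ cong (λ x → bit r k + 2 * x) (⊕-+ j q (r / 2) (m<n*o⇒m/o<n (subst (k <_) (*-comm 2 (2 ^ j)) k<))) ⟩
  bit r k + 2 * (p + (r / 2 ⊕ k / 2))        ≡⟨ solve 3 (λ b p w → b :+ con 2 :* (p :+ w) := con 2 :* p :+ (b :+ con 2 :* w)) refl (bit r k) p (r / 2 ⊕ k / 2) ⟩
  2 * p + (bit r k + 2 * (r / 2 ⊕ k / 2))    ≡⟨ cong (2 * p +_) (⊕-step r k) ⟨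
  2 * p + (r ⊕ k)                            ≡⟨ cong (_+ (r ⊕ k)) (*-assoc 2 (2 ^ j) q) ⟨
  2 * 2 ^ j * q + (r ⊕ k)                    ∎
  where
  open ≡-Reasoning
  open +-*-Solver
  p = 2 ^ j * q

xor-bits : ∀ m n → (m % 2 + bit m n) % 2 ≡ n % 2
xor-bits m n with m % 2 | m%n<n m 2 | n % 2 | m%n<n n 2
... | 0 | _ | 0 | _ = refl
... | 0 | _ | 1 | _ = refl
... | 1 | _ | 0 | _ = refl
... | 1 | _ | 1 | _ = refl
... | suc (suc _) | s≤s (s≤s ()) | _ | _
... | _ | _ | suc (suc _) | s≤s (s≤s ())

-- Only `n` has to fit into `f` digits: the digits of `m` beyond these enter neither XOR.
xorDigits-cancel : ∀ f m {n} → n ≤ f → xorDigits f m (xorDigits f m n) ≡ n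
xorDigits-cancel zero    m z≤n = refl
xorDigits-cancel (suc f) m {n} n≤f = begin
  (m % 2 + w % 2) % 2 + 2 * xorDigits f (m / 2) (w / 2)
    ≡⟨ cong₂ (λ x y → (m % 2 + x) % 2 + 2 * xorDigits f (m / 2) y) w%2 w/2 ⟩
  (m % 2 + bit m n) % 2 + 2 * xorDigits f (m / 2) v
    ≡⟨ cong₂ (λ x y → x + 2 * y) (xor-bits m n) (xorDigits-cancel f (m / 2) (≤1+⇒/2≤ n≤f)) ⟩
  n % 2 + 2 * (n / 2) ≡⟨ m≡m%2+2*[m/2] n ⟨
  n ∎
  where
  open ≡-Reasoning
  v = xorDigits f (m / 2) (n / 2)
  w = bit m n + 2 * v
  b<2 = m%n<n (m % 2 + n % 2) 2
  w%2 : w % 2 ≡ bit m n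
  w%2 = trans (%-remove-+ʳ (bit m n) (m∣m*n v)) (m<n⇒m%n≡m b<2)
  w/2 : w / 2 ≡ v
  w/2 = trans (cong (_/ 2) (+-comm (bit m n) (2 * v)))
    (trans ([2*m+n]/2≡m+n/2 v (bit m n)) (trans (cong (v +_) (m<n⇒m/n≡0 b<2)) (+-identityʳ v)))

⊕-swap : ∀ {m n k} → m ⊕ n ≡ k → m ⊕ k ≡ n
⊕-swap {m} {n} {k} refl = begin
  m ⊕ k                        ≡⟨ ⊕≡xorDigits f (≤-trans (m≤m+n m n) (m≤m+n (m + n) k)) (m≤n+m k (m + n)) ⟩
  xorDigits f m k              ≡⟨ cong (xorDigits f m) (⊕≡xorDigits f (≤-trans (m≤m+n m n) (m≤m+n (m + n) k)) n≤f) ⟩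
  xorDigits f m (xorDigits f m n) ≡⟨ xorDigits-cancel f m n≤f ⟩
  n                            ∎
  where
  open ≡-Reasoning
  f = m + n + k
  n≤f = ≤-trans (m≤n+m n m) (m≤m+n (m + n) k)

-- The seven involutions

-- The irregular initial values: the partner of each `a < 30`, which may itself exceed 29. The last
-- clause serves `c = 6`.
table : ℕ → Vec ℕ 30
table 0 =
  0 ∷ 2 ∷ 1 ∷ 3 ∷ 4 ∷ 5 ∷ 8 ∷ 9 ∷ 6 ∷ 7 ∷ 12 ∷ 13 ∷ 10 ∷ 11 ∷ 14 ∷
  15 ∷ 16 ∷ 17 ∷ 18 ∷ 19 ∷ 20 ∷ 21 ∷ 22 ∷ 23 ∷ 24 ∷ 25 ∷ 26 ∷ 27 ∷ 30 ∷ 31 ∷ []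
table 1 =
  2 ∷ 3 ∷ 0 ∷ 1 ∷ 5 ∷ 4 ∷ 9 ∷ 8 ∷ 7 ∷ 6 ∷ 13 ∷ 12 ∷ 11 ∷ 10 ∷ 15 ∷
  14 ∷ 17 ∷ 16 ∷ 19 ∷ 18 ∷ 21 ∷ 20 ∷ 23 ∷ 22 ∷ 25 ∷ 24 ∷ 27 ∷ 26 ∷ 31 ∷ 30 ∷ []
table 2 =
  1 ∷ 0 ∷ 2 ∷ 4 ∷ 3 ∷ 6 ∷ 5 ∷ 7 ∷ 8 ∷ 9 ∷ 10 ∷ 11 ∷ 12 ∷ 13 ∷ 18 ∷
  19 ∷ 20 ∷ 21 ∷ 14 ∷ 15 ∷ 16 ∷ 17 ∷ 26 ∷ 27 ∷ 28 ∷ 29 ∷ 22 ∷ 23 ∷ 24 ∷ 25 ∷ []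
table 3 =
  3 ∷ 1 ∷ 4 ∷ 0 ∷ 2 ∷ 7 ∷ 6 ∷ 5 ∷ 9 ∷ 8 ∷ 11 ∷ 10 ∷ 13 ∷ 12 ∷ 19 ∷
  18 ∷ 21 ∷ 20 ∷ 15 ∷ 14 ∷ 17 ∷ 16 ∷ 27 ∷ 26 ∷ 29 ∷ 28 ∷ 23 ∷ 22 ∷ 25 ∷ 24 ∷ []
table 4 =
  4 ∷ 5 ∷ 3 ∷ 2 ∷ 0 ∷ 1 ∷ 7 ∷ 6 ∷ 10 ∷ 11 ∷ 8 ∷ 9 ∷ 14 ∷ 15 ∷ 12 ∷
  13 ∷ 18 ∷ 19 ∷ 16 ∷ 17 ∷ 22 ∷ 23 ∷ 20 ∷ 21 ∷ 26 ∷ 27 ∷ 24 ∷ 25 ∷ 28 ∷ 29 ∷ []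
table 5 =
  5 ∷ 4 ∷ 6 ∷ 7 ∷ 1 ∷ 0 ∷ 2 ∷ 3 ∷ 11 ∷ 10 ∷ 9 ∷ 8 ∷ 15 ∷ 14 ∷ 13 ∷
  12 ∷ 19 ∷ 18 ∷ 17 ∷ 16 ∷ 23 ∷ 22 ∷ 21 ∷ 20 ∷ 27 ∷ 26 ∷ 25 ∷ 24 ∷ 29 ∷ 28 ∷ []
table _ = φ₆-table

shift : ℕ → ℕ
shift c = if c <ᵇ 4 then 0 else 2

mask : Parity → ℕ → ℕ
mask z c = if c <ᵇ 4 then alternating z else c ∸ 2
  where
  alternating : Parity → ℕ
  alternating 0ℙ = c ⊕ 2
  alternating 1ℙ = c

-- The argument is x / 8, so the zone of x is the parity of the bit length of
-- ⌊ x / 56 ⌋.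
zone : ℕ → Parity
zone n = parity ⌈log₂ suc (n / 7) ⌉

-- The zone is a separate argument so that a finite search can range over both zones.
eventual : Parity → ℕ → ℕ → ℕ
eventual z c x = x ⊕[ shift c ] mask z c

φ : ℕ → ℕ → ℕ
φ c x with x <? 30
... | yes x<30 = lookup (table c) (fromℕ< x<30)
... | no  _    = eventual (zone (x / 8)) c x

-- Kernel conditions and their finite verification

-- The kernel conditions at (a , g c a , c), where g d describes third pile d and
-- h is the partner of a / 2 in the halved game. Below lo the last condition is
-- not required: in a block of large numbers it holds there automatically.
Good : ℕ → (ℕ → ℕ → ℕ) → ℕ → ℕ → ℕ → Set
Good lo g h c a =
  (g c (g c a) ≡ a) ×
  (∀ {d} → d < c → g d a ≢ g c a) ×
  (0 < c + a → h ≢ g c a / 2) ×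
  (∀ {b} → b < g c a → lo ≤ b →
     g c b < a ⊎ (∃ λ d → d < c × g d a ≡ b) ⊎ h ≡ b / 2)

good? : ∀ lo g h c a → Dec (Good lo g h c a)
good? lo g h c a =
  (g c (g c a) ≟ a) ×-dec
  allUpTo? (λ d → ¬? (g d a ≟ g c a)) c ×-dec
  (0 <? c + a →-dec ¬? (h ≟ g c a / 2)) ×-dec
  allUpTo? (λ b → lo ≤? b →-dec
    (g c b <? a ⊎-dec anyUpTo? (λ d → g d a ≟ b) c ⊎-dec h ≟ b / 2)) (g c a)

origin : ℕ → ℕ
origin c = 8 ∸ shift c

-- Opaque, lest the type checker unfold the exhaustive searches later on.
abstract
  -- The first block of large numbers, `q = 7`, starts at `56 + origin c`. From there on `a / 2` is
  -- at least 30 and lies in the opposite zone. The bound on `φ c a` is the base case of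
  -- `φ-bounded`.
  small : ∀ {c} → c < 7 → ∀ {a} → a < 56 + origin c →
          φ c a < 56 + origin c × Good 0 φ (φ (c / 2) (a / 2)) c a
  small = from-yes (allUpTo? (λ c → allUpTo? (λ a →
    φ c a <? 56 + origin c ×-dec good? 0 φ (φ (c / 2) (a / 2)) c a) (56 + origin c)) 7)

-- A block starts at an origin of 6 or 8 relative to a multiple 8 * q, so it may
-- meet two zones: u on [8 * q , 8 * q + 8) and v on [8 * q + 8 , 8 * q + 16).
pick : Parity → Parity → ℕ → Parity
pick u v zero    = u
pick u v (suc _) = v

window : Parity → Parity → ℕ → ℕ → ℕ
window u v c r = eventual (pick u v (r / 8)) c r

∀ℙ? : {P : Parity → Set} → (∀ z → Dec (P z)) → Dec (∀ z → P z)
∀ℙ? P? with P? 0ℙ | P? 1ℙ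
... | yes p | yes q = yes λ where 0ℙ → p ; 1ℙ → q
... | no ¬p | _     = no λ f → ¬p (f 0ℙ)
... | _     | no ¬q = no λ f → ¬q (f 1ℙ)

InWindow : ℕ → ℕ → Set
InWindow c r = origin c ≤ r × r < 8 + origin c

abstract
  -- Here `r` is an offset from `8 * q`, and `r / 2` one from `4 * q` in the halved game, whose zone
  -- is the opposite one. The four pairs of zones cover every block.
  large : ∀ u v {c} → c < 7 → ∀ {r} → r < 8 + origin c → origin c ≤ r →
          InWindow c (window u v c r) ×
          Good (origin c) (window u v) (eventual (opposite (pick u v (r / 8))) (c / 2) (r / 2)) c r
  large = from-yes (∀ℙ? λ u → ∀ℙ? λ v → allUpTo? (λ c → allUpTo? (λ r → origin c ≤? r →-dec
    ((origin c ≤? window u v c r ×-dec window u v c r <? 8 + origin c) ×-dec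
     good? (origin c) (window u v) (eventual (opposite (pick u v (r / 8))) (c / 2) (r / 2)) c r))
    (8 + origin c)) 7)

-- Translation and halving of large numbers

abstract
  mask<2^ : ∀ z → (∀ {c} → c < 7 → mask z c < 2 ^ 3) × (∀ {c} → c < 4 → mask z c < 2 ^ 2)
  mask<2^ = from-yes (∀ℙ? λ z → allUpTo? (λ c → mask z c <? 2 ^ 3) 7 ×-dec allUpTo? (λ c → mask z c <? 2 ^ 2) 4)

-- The last hypothesis keeps the subtraction of the shift from being truncated. Blocks use `j = 3`;
-- the halved game uses `j = 2`, as half of `8 * q` is in general only a multiple of 4.
eventual-+ : ∀ j q r z c → mask z c < 2 ^ j → shift c ≤ (r + shift c) ⊕ mask z c →
             eventual z c (2 ^ j * q + r) ≡ 2 ^ j * q + eventual z c r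
eventual-+ j q r z c k< s≤ = begin
  (2 ^ j * q + r + shift c) ⊕ mask z c ∸ shift c   ≡⟨ cong (λ x → x ⊕ mask z c ∸ shift c) (+-assoc (2 ^ j * q) r (shift c)) ⟩
  (2 ^ j * q + (r + shift c)) ⊕ mask z c ∸ shift c ≡⟨ cong (_∸ shift c) (⊕-+ j q (r + shift c) k<) ⟩
  2 ^ j * q + ((r + shift c) ⊕ mask z c) ∸ shift c ≡⟨ +-∸-assoc (2 ^ j * q) s≤ ⟩
  2 ^ j * q + eventual z c r                       ∎
  where open ≡-Reasoning

abstract
  -- If the shift is 2, then `r + 2` is at least 8 and stays so under XOR with a mask below 8.
  shift≤ : ∀ z {c} → c < 7 → ∀ {r} → r < 16 → 6 ≤ r → shift c ≤ (r + shift c) ⊕ mask z c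
  shift≤ = from-yes (∀ℙ? λ z → allUpTo? (λ c → allUpTo? (λ r → 6 ≤? r →-dec shift c ≤? (r + shift c) ⊕ mask z c) 16) 7)

  shift≡0 : ∀ {c} → c < 4 → shift c ≡ 0
  shift≡0 = from-yes (allUpTo? (λ c → shift c ≟ 0) 4)

  origin-bounds : ∀ {c} → c < 7 → 6 ≤ origin c × origin c ≤ 8
  origin-bounds = from-yes (allUpTo? (λ c → 6 ≤? origin c ×-dec origin c ≤? 8) 7)

φ≡eventual : ∀ c {x} → 30 ≤ x → φ c x ≡ eventual (zone (x / 8)) c x
φ≡eventual c {x} 30≤x with x <? 30
... | yes x<30 = contradiction 30≤x (<⇒≱ x<30)
... | no  _    = refl

/2≡⌊/2⌋ : ∀ n → n / 2 ≡ ⌊ n /2⌋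
/2≡⌊/2⌋ zero          = refl
/2≡⌊/2⌋ (suc zero)    = refl
/2≡⌊/2⌋ (suc (suc n)) = trans ([2*m+n]/2≡m+n/2 1 n) (cong suc (/2≡⌊/2⌋ n))

-- Halving `n` halves `n / 7`, which is positive, so its bit length drops by exactly one.
zone-/2 : ∀ {n} → 7 ≤ n → zone (n / 2) ≡ opposite (zone n)
zone-/2 {n} 7≤n = begin
  parity ⌈log₂ suc (n / 2 / 7) ⌉          ≡⟨ cong (λ x → parity ⌈log₂ suc x ⌉) (trans (m/n/o≡m/[n*o] n 2 7) (sym (m/n/o≡m/[n*o] n 7 2))) ⟩
  -- `suc ⌊ m /2⌋` is `⌈ suc m /2⌉` by definition.
  parity ⌈log₂ suc (m / 2) ⌉              ≡⟨ cong (λ x → parity ⌈log₂ suc x ⌉) (/2≡⌊/2⌋ m) ⟩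
  parity ⌈log₂ ⌈ suc m /2⌉ ⌉              ≡⟨ cong parity (⌈log₂⌈n/2⌉⌉≡⌈log₂n⌉∸1 (suc m)) ⟩
  parity (ℓ ∸ 1)                          ≡⟨ suc-homo-⁻¹ (ℓ ∸ 1) ⟨
  opposite (parity (suc (ℓ ∸ 1)))         ≡⟨ cong (opposite ∘ parity) (m+[n∸m]≡n {1} {ℓ} (⌈log₂⌉-mono-≤ (s≤s (m≥n⇒m/n>0 7≤n)))) ⟩
  opposite (parity ℓ)                     ∎
  where
  open ≡-Reasoning
  m = n / 7
  ℓ = ⌈log₂ suc m ⌉

[8*q+r]/8≡q+r/8 : ∀ q r → (8 * q + r) / 8 ≡ q + r / 8
[8*q+r]/8≡q+r/8 q r = trans (+-distrib-/-∣ˡ r (m∣m*n q))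
  (cong (_+ r / 8) (trans (cong (_/ 8) (*-comm 8 q)) (m*n/n≡m q 8)))

[8*q+r]/2≡4*q+r/2 : ∀ q r → (8 * q + r) / 2 ≡ 4 * q + r / 2
[8*q+r]/2≡4*q+r/2 q r = trans (cong (λ x → (x + r) / 2) (*-assoc 2 4 q)) ([2*m+n]/2≡m+n/2 (4 * q) r)

pick-zone : ∀ q r → r < 16 → zone ((8 * q + r) / 8) ≡ pick (zone q) (zone (suc q)) (r / 8)
pick-zone q r r<16 rewrite [8*q+r]/8≡q+r/8 q r with r / 8 | m<n*o⇒m/o<n {r} {2} {8} r<16
... | 0           | _ = cong zone (+-identityʳ q)
... | 1           | _ = cong zone (+-comm q 1)
... | suc (suc _) | s≤s (s≤s ())

module _ {q} (7≤q : 7 ≤ q) where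

  private
    u = zone q
    v = zone (suc q)

  φ-window : ∀ {c r} → c < 7 → 6 ≤ r → r < 16 → φ c (8 * q + r) ≡ 8 * q + window u v c r
  φ-window {c} {r} c<7 6≤r r<16 = begin
    φ c (8 * q + r)                                     ≡⟨ φ≡eventual c (≤-trans (m≤m+n 30 26) (≤-trans (*-monoʳ-≤ 8 7≤q) (m≤m+n _ r))) ⟩
    eventual (zone ((8 * q + r) / 8)) c (8 * q + r)     ≡⟨ cong (λ z → eventual z c (8 * q + r)) (pick-zone q r r<16) ⟩
    eventual z c (8 * q + r)                            ≡⟨ eventual-+ 3 q r z c (proj₁ (mask<2^ z) c<7) (shift≤ z c<7 r<16 6≤r) ⟩
    8 * q + window u v c r                              ∎
    where
    open ≡-Reasoning
    z = pick u v (r / 8)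

  -- As `c / 2 < 4`, the shift is 0 and the mask is below 4, so translation by `4 * q` is allowed.
  φ-half : ∀ {c r} → c < 7 → 6 ≤ r → r < 16 →
           φ (c / 2) ((8 * q + r) / 2) ≡ 4 * q + eventual (opposite (pick u v (r / 8))) (c / 2) (r / 2)
  φ-half {c} {r} c<7 6≤r r<16 = begin
    φ d (a / 2)                            ≡⟨ φ≡eventual d 30≤a/2 ⟩
    eventual (zone (a / 2 / 8)) d (a / 2)  ≡⟨ cong₂ (λ z x → eventual z d x) zone≡ ([8*q+r]/2≡4*q+r/2 q r) ⟩
    eventual z d (4 * q + r / 2)           ≡⟨ eventual-+ 2 q (r / 2) z d (proj₂ (mask<2^ z) d<4)
                                                (subst (_≤ (r / 2 + shift d) ⊕ mask z d) (sym (shift≡0 d<4)) z≤n) ⟩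
    4 * q + eventual z d (r / 2)           ∎
    where
    open ≡-Reasoning
    d = c / 2
    a = 8 * q + r
    z = opposite (pick u v (r / 8))
    d<4 : d < 4
    d<4 = m<n*o⇒m/o<n (≤-trans c<7 (n≤1+n 7))
    30≤a/2 : 30 ≤ a / 2
    30≤a/2 = ≤-trans (n≤1+n 30) (/-monoˡ-≤ {62} 2 (+-mono-≤ (*-monoʳ-≤ 8 7≤q) 6≤r))
    zone≡ : zone (a / 2 / 8) ≡ z
    zone≡ = begin
      zone (a / 2 / 8)            ≡⟨ cong zone (trans (m/n/o≡m/[n*o] a 2 8) (sym (m/n/o≡m/[n*o] a 8 2))) ⟩
      zone (a / 8 / 2)            ≡⟨ zone-/2 (subst (7 ≤_) (sym ([8*q+r]/8≡q+r/8 q r)) (≤-trans 7≤q (m≤m+n q _))) ⟩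
      opposite (zone (a / 8))     ≡⟨ cong opposite (pick-zone q r r<16) ⟩
      z                           ∎

-- From blocks to all pile sizes

data Location (o : ℕ) : ℕ → Set where
  below  : ∀ {a} → a < 56 + o → Location o a
  inside : ∀ q r → 7 ≤ q → o ≤ r → r < 8 + o → Location o (8 * q + r)

locate : ∀ o a → Location o a
locate o a with a <? 56 + o
... | yes a<  = below a<
... | no  a≮  = subst (Location o) a≡
    (inside (m / 8) (m % 8 + o) (/-monoˡ-≤ {56} 8 56≤m) (m≤n+m o (m % 8)) (+-monoˡ-< o (m%n<n m 8)))
  where
  open ≡-Reasoning
  m = a ∸ o
  56+o≤a = ≮⇒≥ a≮
  56≤m : 56 ≤ m
  56≤m = subst (_≤ m) (m+n∸n≡m 56 o) (∸-monoˡ-≤ o 56+o≤a)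
  a≡ : 8 * (m / 8) + (m % 8 + o) ≡ a
  a≡ = begin
    8 * (m / 8) + (m % 8 + o)   ≡⟨ +-assoc (8 * (m / 8)) (m % 8) o ⟨
    8 * (m / 8) + m % 8 + o     ≡⟨ cong (_+ o) (trans (+-comm _ (m % 8)) (cong (m % 8 +_) (*-comm 8 (m / 8)))) ⟩
    m % 8 + m / 8 * 8 + o       ≡⟨ cong (_+ o) (m≡m%n+[m/n]*n m 8) ⟨
    m + o                       ≡⟨ m∸n+n≡m (≤-trans (m≤n+m o 56) 56+o≤a) ⟩
    a                           ∎

module _ {c} (c<7 : c < 7) where

  private
    o = origin c
    6≤o = proj₁ (origin-bounds c<7)
    8+o≤16 = +-monoʳ-≤ 8 (proj₂ (origin-bounds c<7))

  -- The numbers below a block form the initial segment and the earlier blocks, each preserved by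
  -- `φ c`.
  φ-bounded : ∀ {q b} → 7 ≤ q → b < 8 * q + o → φ c b < 8 * q + o
  φ-bounded {q} {b} 7≤q b< with locate o b
  ... | below b<′ = ≤-trans (proj₁ (small c<7 b<′)) (+-monoˡ-≤ o (*-monoʳ-≤ 8 7≤q))
  ... | inside q′ r 7≤q′ o≤r r< = begin-strict
    φ c (8 * q′ + r)                          ≡⟨ φ-window 7≤q′ c<7 (≤-trans 6≤o o≤r) (≤-trans r< 8+o≤16) ⟩
    8 * q′ + window (zone q′) (zone (suc q′)) c r <⟨ +-monoʳ-< (8 * q′) (proj₂ (proj₁ (large (zone q′) (zone (suc q′)) c<7 r< o≤r))) ⟩
    8 * q′ + (8 + o)                          ≡⟨ solve 2 (λ x y → con 8 :* x :+ (con 8 :+ y) := con 8 :* (con 1 :+ x) :+ y) refl q′ o ⟩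
    8 * suc q′ + o                            ≤⟨ +-monoˡ-≤ o (*-monoʳ-≤ 8 q′<q) ⟩
    8 * q + o                                 ∎
    where
    open ≤-Reasoning
    open +-*-Solver
    q′<q : q′ < q
    q′<q = *-cancelˡ-< 8 q′ q (+-cancelʳ-< o (8 * q′) (8 * q) (≤-<-trans (+-monoʳ-≤ (8 * q′) o≤r) b<))

  good-inside : ∀ {q r} → 7 ≤ q → o ≤ r → r < 8 + o →
                Good 0 φ (φ (c / 2) ((8 * q + r) / 2)) c (8 * q + r)
  good-inside {q} {r} 7≤q o≤r r< with large (zone q) (zone (suc q)) c<7 r< o≤r
  ... | (o≤g , g<) , involutive , distinct , unhalved , complete =
    trans (cong (φ c) φa) (trans (φ-at c<7 o≤g g<) (cong (8 * q +_) involutive)) ,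
    (λ d<c eq → distinct d<c (+-cancelˡ-≡ (8 * q) _ _ (trans (sym (φ-at (<-trans d<c c<7) o≤r r<)) (trans eq φa)))) ,
    (λ _ eq → unhalved (≤-trans (≤-trans (s≤s z≤n) (≤-trans 6≤o o≤r)) (m≤n+m r c))
      (+-cancelˡ-≡ (4 * q) _ _ (trans (sym φh) (trans eq (trans (cong (_/ 2) φa) ([8*q+r]/2≡4*q+r/2 q (g c r))))))) ,
    λ {b} b< _ → case b <? 8 * q + o of λ where
      -- The partner of a number below the block is also below it, hence less than `a`.
      (yes b<8q+o) → inj₁ (≤-trans (φ-bounded 7≤q b<8q+o) (+-monoʳ-≤ (8 * q) o≤r))
      (no b≮8q+o) → within b (subst (b <_) φa b<) (≮⇒≥ b≮8q+o)
    where
    g = window (zone q) (zone (suc q))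
    φ-at : ∀ {d r} → d < 7 → o ≤ r → r < 8 + o → φ d (8 * q + r) ≡ 8 * q + g d r
    φ-at d<7 o≤r r< = φ-window 7≤q d<7 (≤-trans 6≤o o≤r) (≤-trans r< 8+o≤16)
    φa = φ-at c<7 o≤r r<
    φh = φ-half 7≤q c<7 (≤-trans 6≤o o≤r) (≤-trans r< 8+o≤16)
    within : ∀ b → b < 8 * q + g c r → 8 * q + o ≤ b →
             φ c b < 8 * q + r ⊎ (∃ λ d → d < c × φ d (8 * q + r) ≡ b) ⊎ φ (c / 2) ((8 * q + r) / 2) ≡ b / 2
    within b b< ≤b with b ∸ 8 * q | m+[n∸m]≡n (≤-trans (m≤m+n (8 * q) o) ≤b)
    ... | t | refl = case complete t<g o≤t of λ where
        (inj₁ gt<r) → inj₁ (subst (_< 8 * q + r) (sym (φ-at c<7 o≤t (<-trans t<g g<))) (+-monoʳ-< (8 * q) gt<r))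
        (inj₂ (inj₁ (d , d<c , gd≡t))) →
          inj₂ (inj₁ (d , d<c , trans (φ-at (<-trans d<c c<7) o≤r r<) (cong (8 * q +_) gd≡t)))
        (inj₂ (inj₂ h≡)) → inj₂ (inj₂ (trans φh (trans (cong (4 * q +_) h≡) (sym ([8*q+r]/2≡4*q+r/2 q t)))))
      where
      t<g = +-cancelˡ-< (8 * q) t (g c r) b<
      o≤t = +-cancelˡ-≤ (8 * q) o t ≤b

  good : ∀ a → Good 0 φ (φ (c / 2) (a / 2)) c a
  good a with locate o a
  ... | below a<             = proj₂ (small c<7 a<)
  ... | inside q r 7≤q o≤r r< = good-inside 7≤q o≤r r<

-- From the kernel conditions to winning strategies

mutual
  P∧N⇒⊥ : ∀ {p} → IsP p → IsN p → ⊥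
  P∧N⇒⊥ (isP f) (isN move q) = N∧P⇒⊥ (f move) q

  N∧P⇒⊥ : ∀ {p} → IsN p → IsP p → ⊥
  N∧P⇒⊥ (isN move q) (isP f) = P∧N⇒⊥ q (f move)

sum-/2-≤ : ∀ ps → sum (map (_/ 2) ps) ≤ sum ps
sum-/2-≤ []       = z≤n
sum-/2-≤ (p ∷ ps) = +-mono-≤ (m/n≤m p 2) (sum-/2-≤ ps)

sum-/2-< : ∀ {ps} → Any (0 <_) ps → sum (map (_/ 2) ps) < sum ps
sum-/2-< {suc p ∷ ps} (here _)  = +-mono-<-≤ (m/n<m (suc p) 2 (s≤s (s≤s z≤n))) (sum-/2-≤ ps)
sum-/2-< {p ∷ ps}     (there i) = +-mono-≤-< (m/n≤m p 2) (sum-/2-< i)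

removal-sum-< : ∀ {ps qs} → Removal ps qs → sum qs < sum ps
removal-sum-< (here {ps = ps} n<m) = +-monoˡ-< (sum ps) n<m
removal-sum-< (there {m = m} r)    = +-monoʳ-< m (removal-sum-< r)

move-sum-< : ∀ {ps qs} → ps ⟶ qs → sum qs < sum ps
move-sum-< (remove r) = removal-sum-< r
move-sum-< (halve i)  = sum-/2-< i

Outcome : ℕ → ℕ → ℕ → Set
Outcome a b c = (φ c a ≡ b → IsP (a ∷ b ∷ c ∷ [])) × (φ c a ≢ b → IsN (a ∷ b ∷ c ∷ []))

-- Induction on the number of coins. The first three conditions of `Good` send every move from a
-- kernel position outside the kernel; the fourth gives a move back into it when `b` is too small.
outcome : ∀ {a b c} → c < 7 → Outcome a b c
outcome {a} {b} {c} c<7 = go a b c c<7 (<-wellFounded _)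
  where
  go : ∀ a b c → c < 7 → Acc _<_ (sum (a ∷ b ∷ c ∷ [])) → Outcome a b c
  go a b c c<7 (acc rec) with good c<7 a
  ... | involutive , distinct , unhalved , complete = (λ eq → isP (toN eq)) , fromN
    where
    next : ∀ {a′ b′ c′} → (a ∷ b ∷ c ∷ []) ⟶ (a′ ∷ b′ ∷ c′ ∷ []) → c′ < 7 → Outcome a′ b′ c′
    next move c′<7 = go _ _ _ c′<7 (rec (move-sum-< move))

    nonempty : 0 < c + a → Any (0 <_) (a ∷ b ∷ c ∷ [])
    nonempty 0<c+a with 0 <? a
    ... | yes 0<a = here 0<a
    ... | no  0≮a rewrite n≤0⇒n≡0 (≮⇒≥ 0≮a) = there (there (here (subst (0 <_) (+-identityʳ c) 0<c+a)))

    -- `φ 0 0` is 0, so nothing lies below it.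
    positive : ∀ {b} → b < φ c a → 0 < c + a
    positive {b} b< with 0 <? c + a
    ... | yes 0<c+a = 0<c+a
    ... | no  0≮c+a with n≤0⇒n≡0 (≮⇒≥ 0≮c+a)
    ...   | c+a≡0 rewrite m+n≡0⇒m≡0 c c+a≡0 | m+n≡0⇒n≡0 c c+a≡0 = contradiction b< n≮0

    toN : φ c a ≡ b → ∀ {q} → (a ∷ b ∷ c ∷ []) ⟶ q → IsN q
    -- An involution is injective, so a smaller first pile has another partner.
    toN refl m@(remove (here {n = a′} a′<a)) = proj₂ (next m c<7) λ eq →
      <⇒≢ a′<a (trans (sym (proj₁ (good c<7 a′))) (trans (cong (φ c) eq) involutive))
    toN refl m@(remove (there (here b′<b))) = proj₂ (next m c<7) (<⇒≢ b′<b ∘ sym)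
    toN refl m@(remove (there (there (here c′<c)))) = proj₂ (next m (<-trans c′<c c<7)) (distinct c′<c)
    toN refl (remove (there (there (there ()))))
    toN refl m@(halve any) = proj₂ (next m (≤-<-trans (m/n≤m c 2) c<7)) (unhalved (0<c+a any))
      where
      0<c+a : Any (0 <_) (a ∷ φ c a ∷ c ∷ []) → 0 < c + a
      0<c+a (here 0<a)                  = ≤-trans 0<a (m≤n+m a c)
      0<c+a (there (here 0<b))          = positive 0<b
      0<c+a (there (there (here 0<c)))  = ≤-trans 0<c (m≤m+n c a)
      0<c+a (there (there (there ())))

    win : ∀ {a′ b′ c′} → (a ∷ b ∷ c ∷ []) ⟶ (a′ ∷ b′ ∷ c′ ∷ []) → c′ < 7 → φ c′ a′ ≡ b′ →
          IsN (a ∷ b ∷ c ∷ [])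
    win move c′<7 eq = isN move (proj₁ (next move c′<7) eq)

    fromN : φ c a ≢ b → IsN (a ∷ b ∷ c ∷ [])
    fromN φa≢b with <-cmp (φ c a) b
    ... | tri< φa<b _ _ = win (remove (there (here φa<b))) c<7 refl
    ... | tri≈ _ φa≡b _ = contradiction φa≡b φa≢b
    ... | tri> _ _ b<φa with complete b<φa z≤n
    -- The first pile is reduced to `φ c b`, whose partner is `b` again.
    ...   | inj₁ φb<a                    = win (remove (here φb<a)) c<7 (proj₁ (good c<7 b))
    ...   | inj₂ (inj₁ (d , d<c , φd≡b)) = win (remove (there (there (here d<c)))) (<-trans d<c c<7) φd≡b
    ...   | inj₂ (inj₂ φh≡b/2)           = win (halve (nonempty (positive b<φa))) (≤-<-trans (m/n≤m c 2) c<7) φh≡b/2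

IsP⇔φ : ∀ {a b c} → c < 7 → IsP (a ∷ b ∷ c ∷ []) ⇔ φ c a ≡ b
IsP⇔φ {a} {b} {c} c<7 = mk⇔
  (λ p → decidable-stable (φ c a ≟ b) (P∧N⇒⊥ p ∘ proj₂ (outcome c<7)))
  (proj₁ (outcome c<7))

-- The case of third pile 6

-- For `c = 6` the shift is 2 and the mask is 4 in both zones.
φ₆≡φ : ∀ x → φ₆ x ≡ φ 6 x
φ₆≡φ x with x <? 30
... | yes _ = refl
... | no  _ = refl

φ₆≡⊕[2]4 : ∀ {x} → 30 ≤ x → φ₆ x ≡ x ⊕[ 2 ] 4
φ₆≡⊕[2]4 {x} 30≤x = trans (φ₆≡φ x) (φ≡eventual 6 30≤x)

-- A positive difference is not truncated, so 2 can be added back; XOR with `x` then cancels.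
∸2≡⇔⊕≡ : ∀ {x y k} → 0 < y → (x ⊕ k ∸ 2 ≡ y) ⇔ (x ⊕ (y + 2) ≡ k)
∸2≡⇔⊕≡ {x} {y} {k} 0<y = mk⇔
  (λ eq → ⊕-swap {x} {k} (begin
    x ⊕ k           ≡⟨ m∸n+n≡m (<⇒≤ (2<x⊕k eq)) ⟨
    x ⊕ k ∸ 2 + 2   ≡⟨ cong (_+ 2) eq ⟩
    y + 2           ∎))
  (λ eq → trans (cong (_∸ 2) (⊕-swap {x} {y + 2} eq)) (m+n∸n≡m y 2))
  where
  open ≡-Reasoning
  2<x⊕k : x ⊕ k ∸ 2 ≡ y → 2 < x ⊕ k
  2<x⊕k eq = m∸n≢0⇒n<m {x ⊕ k} {2} (>⇒≢ (subst (0 <_) (sym eq) 0<y))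

theorem31 : (∀ (a b : ℕ) → IsP (a ∷ b ∷ 6 ∷ []) ⇔ (b ≡ φ₆ a)) ×
    (∀ (a b : ℕ) → 30 ≤ a → 30 ≤ b →
    IsP (a ∷ b ∷ 6 ∷ []) ⇔ ((a + 2) ⊕ (b + 2) ≡ 4))
theorem31 = isP⇔ , λ a b 30≤a 30≤b →
  ∸2≡⇔⊕≡ {a + 2} {b} (≤-trans (s≤s z≤n) 30≤b)
  ⇔-∘ (mk⇔ (λ b≡ → sym (trans b≡ (φ₆≡⊕[2]4 30≤a))) (λ ≡b → trans (sym ≡b) (sym (φ₆≡⊕[2]4 30≤a)))
  ⇔-∘ isP⇔ a b)
  where
  isP⇔ : ∀ a b → IsP (a ∷ b ∷ 6 ∷ []) ⇔ (b ≡ φ₆ a)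
  isP⇔ a b = mk⇔ (λ φ≡b → trans (sym φ≡b) (sym (φ₆≡φ a))) (λ b≡ → trans (sym (φ₆≡φ a)) (sym b≡))
    ⇔-∘ IsP⇔φ ≤-refl
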